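{- In the game of Philosophers' Phutball played on a board with $12$ rows and $10$ columns, there exists a drawn configuration: a position (placement of the ball and of chaps, together with a specification of which player is to move) from which each of the two players has a strategy guaranteeing that he or she does not lose, so that under optimal play by both players neither player wins.
   Context: Philosophers' Phutball is a two-player game on the grid points of a board with $m$ rows and $n$ columns. At every moment exactly one grid point is occupied by the ball; some other grid points are occupied by chaps (stones). The two players are Alfred and Betty, who move alternately. On a turn a player either (i) places a chap on an unoccupied grid point, or (ii) moves the ball by a sequence of one or more jumps. A single jump is made in one of the eight directions (horizontal, vertical, diagonal): the grid point adjacent to the ball in that direction must be occupied by a chap; the ball moves over the maximal contiguous line of chaps in that direction and lands on the first point beyond it; all chaps jumped over are removed immediately (so they cannot be reused by later jumps of the same turn). A jump may not leave the board across the left or right sidelines (such a jump is illegal); the four corners count as part of the top/bottom goal lines, not the sidelines, so a jump leaving the board across the top row (including diagonally through a top corner) or across the bottom row is allowed and ends the move. After a jump the player may, but need not, continue jumping. Alfred wins if, at the end of a turn, the ball lies in the topmost row or has crossed the topmost row; Betty wins if, at the end of a turn, the ball lies in the bottommost row or has crossed the bottommost row. (Passing through a goal row in the middle of a multi-jump without ending there is not a win.) A play that never ends in a win for either player is a draw. A configuration is drawn if neither player has a winning strategy from it, i.e. each player can ensure he or she never loses. -}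

module Defs where

open import Data.Nat using (ℕ; zero; suc)
import Data.Nat as N
open import Data.Integer using (ℤ; +_; -[1+_]; _+_; _*_; _≤_; _<_; _≟_)
open import Data.Bool using (Bool; true; false; if_then_else_; _∧_)
open import Data.Product using (Σ; ∃; _×_; _,_; proj₁; proj₂)
open import Relation.Nullary using (¬_; does)
open import Relation.Binary.PropositionalEquality using (_≡_; _≢_)

-- Board: 12 rows, 10 columns.  A grid point is (row , column) with
-- 0 ≤ row < 12 and 0 ≤ column < 10.  Row 0 is the TOP row (Alfred's
-- goal), row 11 is the BOTTOM row (Betty's goal).  Columns 0 and 9 are
-- along the sidelines.  Points are represented in ℤ × ℤ so that jumps
-- leaving the board can be described.

Point : Set
Point = ℤ × ℤ

row col : Point → ℤ
row = proj₁
col = proj₂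

OnBoard : Point → Set
OnBoard (r , c) = ((+ 0 ≤ r) × (r < + 12)) × ((+ 0 ≤ c) × (c < + 10))

-- Chaps: a Boolean occupancy map (only its values at on-board points matter).
Chaps : Set
Chaps = ℤ → ℤ → Bool

HasChap : Chaps → Point → Set
HasChap ch (r , c) = OnBoard (r , c) × (ch r c ≡ true)

NoChap : Chaps → Point → Set
NoChap ch (r , c) = ch r c ≡ false

setAt : Chaps → Point → Bool → Chaps
setAt ch (a , b) v r c = if does (r ≟ a) ∧ does (c ≟ b) then v else ch r c

record Config : Set where
  constructor config
  field
    ball  : Point
    chaps : Chaps
open Config public

data Dir : Set where
  up down right left upRight upLeft downRight downLeft : Dir

dRow dCol : Dir → ℤ
dRow up = -[1+ 0 ]
dRow down = + 1
dRow right = + 0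
dRow left = + 0
dRow upRight = -[1+ 0 ]
dRow upLeft = -[1+ 0 ]
dRow downRight = + 1
dRow downLeft = + 1
dCol up = + 0
dCol down = + 0
dCol right = + 1
dCol left = -[1+ 0 ]
dCol upRight = + 1
dCol upLeft = -[1+ 0 ]
dCol downRight = + 1
dCol downLeft = -[1+ 0 ]

step : Point → Dir → ℕ → Point
step (r , c) d i = (r + (+ i) * dRow d , c + (+ i) * dCol d)

removeLine : Chaps → Point → Dir → ℕ → Chaps
removeLine ch p d zero    = ch
removeLine ch p d (suc k) = setAt (removeLine ch p d k) (step p d (suc k)) false

data Landing : Set where
  onBoard   : Config → Landing
  offTop    : Landing
  offBottom : Landing

data Jump (cf : Config) : Landing → Set where
  jump-on  : (d : Dir) (k : ℕ) →
             (∀ i → 1 N.≤ i → i N.≤ suc k → HasChap (chaps cf) (step (ball cf) d i)) →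
             OnBoard (step (ball cf) d (suc (suc k))) →
             NoChap (chaps cf) (step (ball cf) d (suc (suc k))) →
             Jump cf (onBoard (config (step (ball cf) d (suc (suc k)))
                                      (removeLine (chaps cf) (ball cf) d (suc k))))
  -- leaving the board across the top line (row -1; a corner exit is included)
  jump-top : (d : Dir) (k : ℕ) →
             (∀ i → 1 N.≤ i → i N.≤ suc k → HasChap (chaps cf) (step (ball cf) d i)) →
             row (step (ball cf) d (suc (suc k))) < + 0 →
             Jump cf offTop
  jump-bottom : (d : Dir) (k : ℕ) →
             (∀ i → 1 N.≤ i → i N.≤ suc k → HasChap (chaps cf) (step (ball cf) d i)) →
             + 12 ≤ row (step (ball cf) d (suc (suc k))) →
             Jump cf offBottom
  -- (a landing point in rows 0..11 but outside columns 0..9 crosses a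
  --  sideline: no constructor, hence illegal)

data Jumps (cf : Config) : Landing → Set where
  last : ∀ {L} → Jump cf L → Jumps cf L
  more : ∀ {cf' L} → Jump cf (onBoard cf') → Jumps cf' L → Jumps cf L

data Move (cf : Config) : Landing → Set where
  place : (p : Point) → OnBoard p → NoChap (chaps cf) p → p ≢ ball cf →
          Move cf (onBoard (config (ball cf) (setAt (chaps cf) p true)))
  jumps : ∀ {L} → Jumps cf L → Move cf L

data Player : Set where
  Alfred Betty : Player

other : Player → Player
other Alfred = Betty
other Betty  = Alfred

data Outcome : Set where
  wins     : Player → Outcome
  continue : Config → Outcome

classify : Landing → Outcome
classify offTop    = wins Alfred
classify offBottom = wins Betty
classify (onBoard cf) =
  if does (row (ball cf) ≟ + 0) then wins Alfred
  else if does (row (ball cf) ≟ + 11) then wins Betty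
  else continue cf

Position : Set
Position = Config × Player

Good : Player → (Position → Set) → Player → Outcome → Set
Good P S nxt (wins Q)      = Q ≡ P
Good P S nxt (continue cf) = S (cf , nxt)

-- Player P has a strategy guaranteeing P never loses from pos:
-- there is a set S of positions containing pos, closed under play in
-- which P always picks a suitable move and the opponent moves arbitrarily,
-- and in which the opponent never wins.
CanAvoidLoss : Player → Position → Set₁
CanAvoidLoss P pos =
  Σ (Position → Set) λ S →
    S pos ×
    ((∀ cf → S (cf , P) → ∃ λ L → Move cf L × Good P S (other P) (classify L)) ×
     (∀ cf → S (cf , other P) → ∀ L → Move cf L → Good P S P (classify L)))

ValidPosition : Position → Set
ValidPosition (cf , _) =
  OnBoard (ball cf) × (+ 1 ≤ row (ball cf)) × (row (ball cf) ≤ + 10) ×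
  NoChap (chaps cf) (ball cf)

Drawn : Position → Set₁
Drawn pos = CanAvoidLoss Alfred pos × CanAvoidLoss Betty pos

-- Two configurations recur, both with Alfred to move: the chaps are those of  grid , and the
-- ball is at (5 , 4) or (7 , 6).  Betty threatens to set up an unstoppable win, and the only
-- answer is for Alfred to put a chap at (6 , 5), which creates a threat of his own that Betty
-- can only parry by jumping over that chap.  The jump removes it and takes the ball from one
-- of the two points to the other, so that the play repeats.  Every other move of either
-- player loses within a few moves.  Both strategies are therefore finite trees whose leaves
-- are wins or a recurring configuration, which can be verified by evaluation.

module Submission where

open import Defs
open import Data.Bool using (Bool; true; false; if_then_else_; _∧_; _∨_; not)
import Data.Bool.Properties as 𝔹ₚ
open import Data.Bool.Properties using (∧-conicalˡ; ∧-conicalʳ; T-≡; not-¬)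
open import Data.Empty using (⊥; ⊥-elim)
open import Data.Integer using (+_; -[1+_]; _+_; _*_; _≤_; _<_; _≟_; +≤+; +<+; -<+)
import Data.Integer.Properties as ℤₚ
open import Data.Integer.Tactic.RingSolver using (solve-∀)
open import Data.List using (List; []; _∷_)
open import Data.List.Membership.Propositional using (_∈_)
open import Data.List.Properties using (≡-dec)
open import Data.List.Relation.Unary.Any using (here; there)
open import Data.Nat as ℕ using (ℕ; zero; suc; _<ᵇ_; _≡ᵇ_; s≤s; z≤n)
import Data.Nat.Properties as ℕₚ
open import Data.Product using (Σ; ∃; _×_; _,_; proj₁; proj₂)
open import Data.Sum using (_⊎_; inj₁; inj₂)
open import Data.Unit using (⊤; tt)
open import Function using (_∘_; Equivalence)
open import Relation.Binary.PropositionalEquality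
open import Relation.Nullary using (Dec; does; yes; no)
open import Relation.Nullary.Decidable using (dec-true; dec-false)

-- Finite grids and Boolean tests on points.

Grid : Set
Grid = List (List Bool)

nth : {A : Set} → A → List A → ℕ → A
nth d []       _       = d
nth d (x ∷ _)  zero    = x
nth d (_ ∷ xs) (suc n) = nth d xs n

-- Short lists are extended by the default value, so that no length invariant is needed.
adjust : {A : Set} → A → (A → A) → List A → ℕ → List A
adjust d f []       zero    = f d ∷ []
adjust d f (x ∷ xs) zero    = f x ∷ xs
adjust d f []       (suc n) = d ∷ adjust d f [] n
adjust d f (x ∷ xs) (suc n) = x ∷ adjust d f xs n

nth-adjust-≡ : ∀ {A : Set} (d : A) f xs n → nth d (adjust d f xs n) n ≡ f (nth d xs n)
nth-adjust-≡ d f []       zero    = refl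
nth-adjust-≡ d f (x ∷ xs) zero    = refl
nth-adjust-≡ d f []       (suc n) = nth-adjust-≡ d f [] n
nth-adjust-≡ d f (x ∷ xs) (suc n) = nth-adjust-≡ d f xs n

nth-adjust-≢ : ∀ {A : Set} (d : A) f xs {m n} → m ≢ n → nth d (adjust d f xs m) n ≡ nth d xs n
nth-adjust-≢ d f []       {zero}  {zero}        m≢n = ⊥-elim (m≢n refl)
nth-adjust-≢ d f (x ∷ xs) {zero}  {zero}        m≢n = ⊥-elim (m≢n refl)
nth-adjust-≢ d f []       {zero}  {suc n}       m≢n = refl
nth-adjust-≢ d f (x ∷ xs) {zero}  {suc n}       m≢n = refl
nth-adjust-≢ d f []       {suc m} {zero}        m≢n = refl
nth-adjust-≢ d f (x ∷ xs) {suc m} {zero}        m≢n = refl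
nth-adjust-≢ d f []       {suc m} {suc n}       m≢n = nth-adjust-≢ d f [] (m≢n ∘ cong suc)
nth-adjust-≢ d f (x ∷ xs) {suc m} {suc n}       m≢n = nth-adjust-≢ d f xs (m≢n ∘ cong suc)

at : Grid → Point → Bool
at g (+ r , + c) = nth false (nth [] g r) c
at g _           = false

put : Grid → Point → Bool → Grid
put g (+ r , + c) v = adjust [] (λ row → adjust false (λ _ → v) row c) g r
put g _           v = g

-- Both tests below compute with Booleans on naturals, so that the final checks can be evaluated.
-- The value `false` at a negative coordinate does no harm, as reflexivity is claimed on the board
-- only.
_==_ : Point → Point → Bool
(+ r , + c) == (+ r′ , + c′) = (r ≡ᵇ r′) ∧ (c ≡ᵇ c′)
_           == _             = false

onBoard? : Point → Bool
onBoard? (+ r , + c) = (r <ᵇ 12) ∧ (c <ᵇ 10)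
onBoard? _           = false

≡ᵇ-true : ∀ m n → (m ≡ᵇ n) ≡ true → m ≡ n
≡ᵇ-true m n e = ℕₚ.≡ᵇ⇒≡ m n (Equivalence.from T-≡ e)

<ᵇ-true : ∀ m n → (m <ᵇ n) ≡ true → m ℕ.< n
<ᵇ-true m n e = ℕₚ.<ᵇ⇒< m n (Equivalence.from T-≡ e)

true-<ᵇ : ∀ {m n} → m ℕ.< n → (m <ᵇ n) ≡ true
true-<ᵇ m<n = Equivalence.to T-≡ (ℕₚ.<⇒<ᵇ m<n)

==-true : ∀ p q → (p == q) ≡ true → p ≡ q
==-true (+ r , + c) (+ r′ , + c′) e
  rewrite ≡ᵇ-true r r′ (∧-conicalˡ _ _ e) | ≡ᵇ-true c c′ (∧-conicalʳ (r ≡ᵇ r′) _ e) = refl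
==-true (+ _ , + _)       (+ _ , -[1+ _ ]) ()
==-true (+ _ , + _)       (-[1+ _ ] , _) ()
==-true (+ _ , -[1+ _ ])  _ ()
==-true (-[1+ _ ] , _)    _ ()

≡ᵇ-refl : ∀ n → (n ≡ᵇ n) ≡ true
≡ᵇ-refl zero    = refl
≡ᵇ-refl (suc n) = ≡ᵇ-refl n

==-refl : ∀ p → OnBoard p → (p == p) ≡ true
==-refl (+ r , + c) _ rewrite ≡ᵇ-refl r = ≡ᵇ-refl c
==-refl (-[1+ _ ] , _) ((() , _) , _)
==-refl (+ _ , -[1+ _ ]) (_ , (() , _))

onBoard?-sound : ∀ p → onBoard? p ≡ true → OnBoard p
onBoard?-sound (+ r , + c) e =
  (+≤+ z≤n , +<+ (<ᵇ-true r 12 (∧-conicalˡ (r <ᵇ 12) _ e))) ,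
  (+≤+ z≤n , +<+ (<ᵇ-true c 10 (∧-conicalʳ (r <ᵇ 12) _ e)))
onBoard?-sound (-[1+ _ ] , _) ()
onBoard?-sound (+ _ , -[1+ _ ]) ()

onBoard?-complete : ∀ p → OnBoard p → onBoard? p ≡ true
onBoard?-complete (+ r , + c) ((_ , +<+ r<) , (_ , +<+ c<)) rewrite true-<ᵇ r< = true-<ᵇ c<
onBoard?-complete (-[1+ _ ] , _) ((() , _) , _)
onBoard?-complete (+ _ , -[1+ _ ]) (_ , (() , _))

-- Representing configurations by grids.

infix 4 _≈_

-- Values off the board do not affect the rules. Agreement on the board lets the check run on one
-- list while the strategy covers every occupancy map that looks like it, without function
-- extensionality.
_≈_ : Chaps → Grid → Set
ch ≈ g = ∀ r c → OnBoard (r , c) → ch r c ≡ at g (r , c)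

setAt-≡ : ∀ ch a b v → setAt ch (a , b) v a b ≡ v
setAt-≡ ch a b v rewrite dec-true (a ≟ a) refl | dec-true (b ≟ b) refl = refl

setAt-≢ʳ : ∀ ch a b v {r} c → r ≢ a → setAt ch (a , b) v r c ≡ ch r c
setAt-≢ʳ ch a b v {r} c r≢a rewrite dec-false (r ≟ a) r≢a = refl

setAt-≢ᶜ : ∀ ch a b v r {c} → c ≢ b → setAt ch (a , b) v r c ≡ ch r c
setAt-≢ᶜ ch a b v r {c} c≢b rewrite dec-false (c ≟ b) c≢b with does (r ≟ a)
... | true  = refl
... | false = refl

setAt-≈ : ∀ {ch g} p v → OnBoard p → ch ≈ g → setAt ch p v ≈ put g p v
setAt-≈ {ch} {g} (+ a , + b) v _ h (+ r) (+ c) on with r ℕ.≟ a | c ℕ.≟ b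
... | yes refl | yes refl
  rewrite setAt-≡ ch (+ a) (+ b) v
        | nth-adjust-≡ [] (λ row → adjust false (λ _ → v) row b) g a
        | nth-adjust-≡ false (λ _ → v) (nth [] g a) b = refl
... | yes refl | no c≢b
  rewrite setAt-≢ᶜ ch (+ a) (+ b) v (+ a) (c≢b ∘ ℤₚ.+-injective)
        | nth-adjust-≡ [] (λ row → adjust false (λ _ → v) row b) g a
        | nth-adjust-≢ false (λ _ → v) (nth [] g a) (c≢b ∘ sym) = h _ _ on
... | no r≢a | _
  rewrite setAt-≢ʳ ch (+ a) (+ b) v (+ c) (r≢a ∘ ℤₚ.+-injective)
        | nth-adjust-≢ [] (λ row → adjust false (λ _ → v) row b) g (r≢a ∘ sym) = h _ _ on
setAt-≈ (+ _ , + _) v _ h (+ _) -[1+ _ ] (_ , (() , _))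
setAt-≈ (+ _ , + _) v _ h -[1+ _ ] _ ((() , _) , _)
setAt-≈ (-[1+ _ ] , _) v ((() , _) , _) h
setAt-≈ (+ _ , -[1+ _ ]) v (_ , (() , _)) h

Rep : Config → Point → Grid → Set
Rep cf q g = ball cf ≡ q × chaps cf ≈ g

-- Computing a single jump.

data Ray : Set where
  none stuck side top bottom : Ray
  land : Point → Grid → Ray

advance : Point → Dir → Point
advance (r , c) d = r + dRow d , c + dCol d

-- Meant for points off the board. The row is tested first, so leaving through a corner crosses a
-- goal line and not a sideline.
exit : Point → Ray
exit (-[1+ _ ] , _) = top
exit (+ r , _)      = if r <ᵇ 12 then side else bottom

-- Chaps are looked up in the original grid `g`, as the rules demand, and removed from `h`. The
-- removal lags by one point: `p` is a chap that is still to be removed.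
walk : ℕ → Grid → Grid → Point → Dir → Ray
walk zero    g h p d = stuck
walk (suc n) g h p d =
  if onBoard? (advance p d)
  then (if at g (advance p d)
        then walk n g (put h p false) (advance p d) d
        else land (advance p d) (put h p false))
  else exit (advance p d)

rayFrom : ℕ → Grid → Point → Dir → Ray
rayFrom n g p d = if onBoard? p ∧ at g p then walk n g g p d else none

ray : Grid → Point → Dir → Ray
ray g q d = rayFrom 12 g (advance q d) d

-- Exhausted fuel gives `stuck`, which says nothing about the landing. All later checks reject it,
-- so no bound on the length of a line has to be proved.
Matches : Ray → Landing → Set
Matches none       L = ⊥
Matches side       L = ⊥
Matches stuck      L = ⊤
Matches top        L = L ≡ offTop
Matches bottom     L = L ≡ offBottom
Matches (land p g) L = Σ Config λ cf → L ≡ onBoard cf × Rep cf p g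

-- Computed rays are exactly the legal jumps.

coord-suc : ∀ x i e → x + (+ i) * e + e ≡ x + (+ suc i) * e
coord-suc x i e = lemma x (+ i) e
  where
  lemma : ∀ x i e → x + i * e + e ≡ x + (+ 1 + i) * e
  lemma = solve-∀

advance-step : ∀ p d i → advance (step p d i) d ≡ step p d (suc i)
advance-step (r , c) d i = cong₂ _,_ (coord-suc r i (dRow d)) (coord-suc c i (dCol d))

advance-one : ∀ p d → advance p d ≡ step p d 1
advance-one (r , c) d =
  cong₂ _,_ (cong (λ z → r + z) (sym (ℤₚ.*-identityˡ (dRow d)))) (cong (λ z → c + z) (sym (ℤₚ.*-identityˡ (dCol d))))

-- Splits a jump into its line of chaps and the way it ends, so that one induction along the line
-- treats all three constructors of `Jump`.
data End (cf : Config) (d : Dir) (k : ℕ) : Landing → Set where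
  within : OnBoard (step (ball cf) d (suc (suc k))) →
        NoChap (chaps cf) (step (ball cf) d (suc (suc k))) →
        End cf d k (onBoard (config (step (ball cf) d (suc (suc k)))
                                    (removeLine (chaps cf) (ball cf) d (suc k))))
  top : row (step (ball cf) d (suc (suc k))) < + 0 → End cf d k offTop
  bot : + 12 ≤ row (step (ball cf) d (suc (suc k))) → End cf d k offBottom

Line : Config → Dir → ℕ → Set
Line cf d k = ∀ i → 1 ℕ.≤ i → i ℕ.≤ k → HasChap (chaps cf) (step (ball cf) d i)

Line-suc : ∀ {cf d k} → Line cf d k → HasChap (chaps cf) (step (ball cf) d (suc k)) → Line cf d (suc k)
Line-suc {k = k} l h i 1≤i i≤ with ℕₚ.m≤n⇒m<n∨m≡n i≤
... | inj₁ (s≤s i≤k) = l i 1≤i i≤k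
... | inj₂ refl      = h

view : ∀ {cf L} → Jump cf L → Σ Dir λ d → Σ ℕ λ k → Line cf d (suc k) × End cf d k L
view (jump-on d k l o n)   = d , k , l , within o n
view (jump-top d k l t)    = d , k , l , top t
view (jump-bottom d k l b) = d , k , l , bot b

unview : ∀ {cf L d k} → Line cf d (suc k) → End cf d k L → Jump cf L
unview l (within o n) = jump-on _ _ l o n
unview l (top t)  = jump-top _ _ l t
unview l (bot b)  = jump-bottom _ _ l b

exit-top : ∀ p → row p < + 0 → onBoard? p ≡ false × exit p ≡ top
exit-top (-[1+ _ ] , _) _ = refl , refl
exit-top (+ _ , _) (+<+ ())

≥⇒<ᵇ-false : ∀ {m n} → n ℕ.≤ m → (m <ᵇ n) ≡ false
≥⇒<ᵇ-false {m} {n} n≤m with m <ᵇ n in e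
... | true  = ⊥-elim (ℕₚ.<⇒≱ (<ᵇ-true m n e) n≤m)
... | false = refl

exit-bottom : ∀ p → + 12 ≤ row p → onBoard? p ≡ false × exit p ≡ bottom
exit-bottom (+ r , + c)      (+≤+ 12≤r) rewrite ≥⇒<ᵇ-false 12≤r = refl , refl
exit-bottom (+ r , -[1+ c ]) (+≤+ 12≤r) rewrite ≥⇒<ᵇ-false 12≤r = refl , refl

exit-cases : ∀ p → (exit p ≡ top × row p < + 0) ⊎ (exit p ≡ bottom × + 12 ≤ row p) ⊎ exit p ≡ side
exit-cases (-[1+ _ ] , _) = inj₁ (refl , -<+)
exit-cases (+ r , _) with r <ᵇ 12 in e
... | true  = inj₂ (inj₂ refl)
... | false = inj₂ (inj₁ (refl , +≤+ (ℕₚ.≮⇒≥ λ r<12 → not-¬ refl (trans (sym e) (true-<ᵇ r<12)))))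

-- Induction on the fuel. At point `suc j` of the line, `h` has lost the first `j` chaps. If
-- `j < k`, the next point holds another chap; if `j = k`, the jump ends there.
walk-complete : ∀ n {cf g h d k L} j → chaps cf ≈ g → Line cf d (suc k) → End cf d k L → j ℕ.≤ k →
                removeLine (chaps cf) (ball cf) d j ≈ h →
                Matches (walk n g h (step (ball cf) d (suc j)) d) L
walk-complete zero j _ _ _ _ _ = tt
walk-complete (suc n) {cf} {g} {h} {d} {k} j cf≈g l e j≤k r≈h
  rewrite advance-step (ball cf) d (suc j)
  with ℕₚ.m≤n⇒m<n∨m≡n j≤k
... | inj₁ j<k
  rewrite onBoard?-complete _ (proj₁ (l (suc (suc j)) (s≤s z≤n) (s≤s j<k)))
        | trans (sym (cf≈g _ _ (proj₁ (l (suc (suc j)) (s≤s z≤n) (s≤s j<k))))) (proj₂ (l (suc (suc j)) (s≤s z≤n) (s≤s j<k)))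
  = walk-complete n (suc j) cf≈g l e j<k
      (setAt-≈ {g = h} _ false (proj₁ (l (suc j) (s≤s z≤n) (s≤s j≤k))) r≈h)
walk-complete (suc n) {cf} {g} {h} {d} {k} j cf≈g l (within o nc) j≤k r≈h | inj₂ refl
  rewrite onBoard?-complete _ o | trans (sym (cf≈g _ _ o)) nc
  = _ , refl , refl , setAt-≈ {g = h} _ false (proj₁ (l (suc j) (s≤s z≤n) (s≤s j≤k))) r≈h
walk-complete (suc n) {cf} {d = d} {k} j _ _ (top t) _ _ | inj₂ refl
  rewrite proj₁ (exit-top (step (ball cf) d (suc (suc k))) t)
        | proj₂ (exit-top (step (ball cf) d (suc (suc k))) t) = refl
walk-complete (suc n) {cf} {d = d} {k} j _ _ (bot b) _ _ | inj₂ refl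
  rewrite proj₁ (exit-bottom (step (ball cf) d (suc (suc k))) b)
        | proj₂ (exit-bottom (step (ball cf) d (suc (suc k))) b) = refl

-- `outcome` below accepts `none` and `side` vacuously, which is right for moves of the opponent. A
-- player's own jump must pass this test as well.
proper : Ray → Bool
proper top        = true
proper bottom     = true
proper (land _ _) = true
proper _          = false

-- The chaps met so far accumulate in the hypothesis `Line`, which forms a jump together with the
-- point where the walk ends.
walk-sound : ∀ n {cf g h d} j → chaps cf ≈ g → Line cf d (suc j) →
             removeLine (chaps cf) (ball cf) d j ≈ h →
             proper (walk n g h (step (ball cf) d (suc j)) d) ≡ true →
             Σ Landing λ L → Jump cf L × Matches (walk n g h (step (ball cf) d (suc j)) d) L
walk-sound zero j _ _ _ ()
walk-sound (suc n) {cf} {g} {h} {d} j cf≈g l r≈h ok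
  rewrite advance-step (ball cf) d (suc j)
  with onBoard? (step (ball cf) d (suc (suc j))) in ob
... | true with at g (step (ball cf) d (suc (suc j))) in oc
...   | true  = walk-sound n (suc j) cf≈g
                  (Line-suc {cf} {d} l (onBoard?-sound _ ob , trans (cf≈g _ _ (onBoard?-sound _ ob)) oc))
                  (setAt-≈ {g = h} _ false (proj₁ (l (suc j) (s≤s z≤n) ℕₚ.≤-refl)) r≈h) ok
...   | false = _ , unview l (within (onBoard?-sound _ ob) (trans (cf≈g _ _ (onBoard?-sound _ ob)) oc)) ,
                _ , refl , refl , setAt-≈ {g = h} _ false (proj₁ (l (suc j) (s≤s z≤n) ℕₚ.≤-refl)) r≈h
walk-sound (suc n) {cf} {g} {h} {d} j cf≈g l r≈h ok | false
  -- Abstracting both at once fixes the result of the walk along with the row bound that the jump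
  -- needs.
  with exit (step (ball cf) d (suc (suc j))) | exit-cases (step (ball cf) d (suc (suc j)))
... | .top    | inj₁ (refl , t)        = offTop , unview l (top t) , refl
... | .bottom | inj₂ (inj₁ (refl , b)) = offBottom , unview l (bot b) , refl
walk-sound (suc n) j cf≈g l r≈h () | false | .side | inj₂ (inj₂ refl)

rayFrom-complete : ∀ n {cf g d k L} → chaps cf ≈ g → Line cf d (suc k) → End cf d k L →
                   Matches (rayFrom n g (step (ball cf) d 1) d) L
rayFrom-complete n {cf} {g} {d} cf≈g l e with l 1 (s≤s z≤n) (s≤s z≤n)
... | o , chap rewrite onBoard?-complete _ o | trans (sym (cf≈g _ _ o)) chap =
  walk-complete n 0 cf≈g l e z≤n cf≈g

rayFrom-sound : ∀ n {cf g d} → chaps cf ≈ g → proper (rayFrom n g (step (ball cf) d 1) d) ≡ true →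
                Σ Landing λ L → Jump cf L × Matches (rayFrom n g (step (ball cf) d 1) d) L
rayFrom-sound n {cf} {g} {d} cf≈g ok
  with onBoard? (step (ball cf) d 1) in ob | at g (step (ball cf) d 1) in oc
... | true | true = walk-sound n 0 cf≈g line cf≈g ok
  where
  line : Line cf d 1
  line (suc zero) _ _ = onBoard?-sound _ ob , trans (cf≈g _ _ (onBoard?-sound _ ob)) oc
  line (suc (suc _)) _ (s≤s ())
rayFrom-sound n cf≈g () | true  | false
rayFrom-sound n cf≈g () | false | _

ray-complete : ∀ {cf q g L} → Rep cf q g → Jump cf L → Σ Dir λ d → Matches (ray g q d) L
ray-complete {cf} {g = g} {L} (refl , cf≈g) J with view J
... | d , k , l , e = d , subst (λ p → Matches (rayFrom 12 g p d) L) (sym (advance-one (ball cf) d))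
                             (rayFrom-complete 12 cf≈g l e)

ray-sound : ∀ {cf q g} d → Rep cf q g → proper (ray g q d) ≡ true →
            Σ Landing λ L → Jump cf L × Matches (ray g q d) L
ray-sound {cf} {g = g} d (refl , cf≈g) =
  subst (λ p → proper (rayFrom 12 g p d) ≡ true → Σ Landing λ L → Jump cf L × Matches (rayFrom 12 g p d) L)
        (sym (advance-one (ball cf) d)) (rayFrom-sound 12 cf≈g)

-- Strategy trees.

data Att : Set
data Def : Set

-- A node of `Att` chooses one move of the player who owns the strategy; a node of `Def` answers all
-- moves of the opponent. A leaf `loop` closes a branch at a recurring configuration.
data Att where
  loop  : Att
  jump  : Dir → List Dir → Def → Att
  place : Point → Def → Att

-- In  reply a ps js  the lists assign answers to the opponent's placements (keyed by the
-- point) and jumps (keyed by the landing point); all other moves are answered by a.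
data Def where
  loop  : Def
  reply : Att → List (Point × Att) → List (Point × Att) → Def

find : Point → List (Point × Att) → Att → Att
find p []             a = a
find p ((q , b) ∷ xs) a = if p == q then b else find p xs a

follow     : Dir → List Dir → Grid → Point → Ray
thenFollow : Dir → List Dir → Ray → Ray

follow d []       g q = ray g q d
follow d (e ∷ ds) g q = thenFollow e ds (ray g q d)

thenFollow d ds (land p h) = follow d ds h p
thenFollow d ds _          = none

follow-sound : ∀ d ds {cf q g} → Rep cf q g → proper (follow d ds g q) ≡ true →
               Σ Landing λ L → Jumps cf L × Matches (follow d ds g q) L
follow-sound d [] rep ok with ray-sound d rep ok
... | L , J , m = L , last J , m
follow-sound d (e ∷ ds) {q = q} {g} rep ok with ray g q d in eq
... | land p h with ray-sound d rep (cong proper eq)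
... | L , J , m with subst (λ r → Matches r L) eq m
... | cf′ , refl , rep′ with follow-sound e ds rep′ ok
... | L′ , Js , m′ = L′ , more J Js , m′

-- Finite quantification over points and directions.

allBelow : ℕ → (ℕ → Bool) → Bool
allBelow zero    f = true
allBelow (suc n) f = f zero ∧ allBelow n (λ i → f (suc i))

allBelow-sound : ∀ n f → allBelow n f ≡ true → ∀ {i} → i ℕ.< n → f i ≡ true
allBelow-sound (suc n) f ok {zero}  _         = ∧-conicalˡ _ _ ok
allBelow-sound (suc n) f ok {suc i} (s≤s i<n) =
  allBelow-sound n (λ i → f (suc i)) (∧-conicalʳ (f zero) _ ok) i<n

allCells : (Point → Bool) → Bool
allCells f = allBelow 12 λ r → allBelow 10 λ c → f (+ r , + c)

allCells-sound : ∀ f → allCells f ≡ true → ∀ p → OnBoard p → f p ≡ true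
allCells-sound f ok (+ r , + c) ((_ , +<+ r<12) , (_ , +<+ c<10)) =
  allBelow-sound 10 (λ c → f (+ r , + c)) (allBelow-sound 12 (λ r → allBelow 10 λ c → f (+ r , + c)) ok r<12) c<10
allCells-sound f ok (-[1+ _ ] , _)  ((() , _) , _)
allCells-sound f ok (+ _ , -[1+ _ ]) (_ , (() , _))

allDirs : (Dir → Bool) → Bool
allDirs f = f up ∧ f down ∧ f right ∧ f left ∧ f upRight ∧ f upLeft ∧ f downRight ∧ f downLeft

allDirs-sound : ∀ f → allDirs f ≡ true → ∀ d → f d ≡ true
allDirs-sound f ok d with f up in e₁ | f down in e₂ | f right in e₃ | f left in e₄
                        | f upRight in e₅ | f upLeft in e₆ | f downRight in e₇ | f downLeft in e₈
allDirs-sound f refl up        | true | true | true | true | true | true | true | true = e₁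
allDirs-sound f refl down      | true | true | true | true | true | true | true | true = e₂
allDirs-sound f refl right     | true | true | true | true | true | true | true | true = e₃
allDirs-sound f refl left      | true | true | true | true | true | true | true | true = e₄
allDirs-sound f refl upRight   | true | true | true | true | true | true | true | true = e₅
allDirs-sound f refl upLeft    | true | true | true | true | true | true | true | true = e₆
allDirs-sound f refl downRight | true | true | true | true | true | true | true | true = e₇
allDirs-sound f refl downLeft  | true | true | true | true | true | true | true | true = e₈

-- Verifying strategy trees by evaluation.

is : Player → Player → Bool
is Alfred Alfred = true
is Betty  Betty  = true
is _      _      = false

is-sound : ∀ P Q → is P Q ≡ true → P ≡ Q
is-sound Alfred Alfred _ = refl
is-sound Betty  Betty  _ = refl

_≟ᵍ_ : (g h : Grid) → Dec (g ≡ h)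
_≟ᵍ_ = ≡-dec (≡-dec 𝔹ₚ._≟_)

-- The strategies below stay inside  loops , the list of configurations that recur with
-- Alfred to move, until X has won.
module Strategy (X : Player) (loops : List (Point × Grid)) where

  -- The invariant set for `CanAvoidLoss`. It is inductive: infinite play is cut at `loop`, which
  -- records no move. Since `loop` has Alfred to move, X moves next there if X is Alfred, and the
  -- opponent otherwise.
  data Safe : Position → Set where
    loop : ∀ {cf q g} → Rep cf q g → (q , g) ∈ loops → Safe (cf , Alfred)
    move : ∀ {cf L} → Move cf L → Good X Safe (other X) (classify L) → Safe (cf , X)
    wait : ∀ {cf P} → P ≡ other X → (∀ L → Move cf L → Good X Safe X (classify L)) → Safe (cf , P)

  inLoops : Grid → Point → List (Point × Grid) → Bool
  inLoops g q []             = false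
  inLoops g q ((p , h) ∷ xs) = (q == p) ∧ does (g ≟ᵍ h) ∨ inLoops g q xs

  inLoops-sound : ∀ g q xs → inLoops g q xs ≡ true → (q , g) ∈ xs
  inLoops-sound g q ((p , h) ∷ xs) ok with q == p in e | g ≟ᵍ h
  ... | true  | yes refl rewrite ==-true q p e = here refl
  ... | true  | no _     = there (inLoops-sound g q xs ok)
  ... | false | _        = there (inLoops-sound g q xs ok)

  outcome : (Grid → Point → Bool) → Ray → Bool
  outcome k none       = true
  outcome k side       = true
  outcome k stuck      = false
  outcome k top        = is X Alfred
  outcome k bottom     = is X Betty
  outcome k (land p h) =
    if does (row p ≟ + 0) then is X Alfred else if does (row p ≟ + 11) then is X Betty else k h p

  outcome-sound : ∀ {k P} r {L} → Matches r L → outcome k r ≡ true →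
                  (∀ {cf p h} → Rep cf p h → k h p ≡ true → Safe (cf , P)) →
                  Good X Safe P (classify L)
  outcome-sound top    refl ok _ = sym (is-sound X Alfred ok)
  outcome-sound bottom refl ok _ = sym (is-sound X Betty ok)
  outcome-sound (land p h) (cf , refl , rep@(refl , _)) ok f with does (row (ball cf) ≟ + 0)
  ... | true  = sym (is-sound X Alfred ok)
  ... | false with does (row (ball cf) ≟ + 11)
  ...   | true  = sym (is-sound X Betty ok)
  ...   | false = f rep ok

  -- After each jump the opponent may stop or go on, so both are tested, even in a goal row.
  -- Exhausted fuel is rejected: a successful check shows that no sequence of jumps was cut short.
  sequel : ℕ → (Grid → Point → Bool) → Ray → Bool
  opposingJumps : ℕ → (Grid → Point → Bool) → Grid → Point → Bool

  sequel n k (land p h) = outcome k (land p h) ∧ opposingJumps n k h p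
  sequel n k r          = outcome k r

  opposingJumps zero    k g q = false
  opposingJumps (suc n) k g q = allDirs (λ d → sequel n k (ray g q d))

  sequel-outcome : ∀ n k r → sequel n k r ≡ true → outcome k r ≡ true
  sequel-outcome n k none       ok = ok
  sequel-outcome n k stuck      ok = ok
  sequel-outcome n k side       ok = ok
  sequel-outcome n k top        ok = ok
  sequel-outcome n k bottom     ok = ok
  sequel-outcome n k (land p h) ok = ∧-conicalˡ _ _ ok

  opposingJumps-sound : ∀ n {k P} {cf q g L} → Rep cf q g → opposingJumps n k g q ≡ true →
                        (∀ {cf p h} → Rep cf p h → k h p ≡ true → Safe (cf , P)) →
                        Jumps cf L → Good X Safe P (classify L)
  opposingJumps-sound (suc n) {k} {q = q} {g} rep ok f (last J) with ray-complete rep J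
  ... | d , m = outcome-sound (ray g q d) m
                  (sequel-outcome n k (ray g q d) (allDirs-sound (λ d → sequel n k (ray g q d)) ok d)) f
  opposingJumps-sound (suc n) {k} {q = q} {g} rep ok f (more J Js)
    with ray-complete rep J
  ... | d , m with ray g q d | allDirs-sound (λ d → sequel n k (ray g q d)) ok d
  opposingJumps-sound (suc n) {k} rep ok f (more J Js) | d , (cf′ , refl , rep′) | land p h | ok′ =
    opposingJumps-sound n rep′ (∧-conicalʳ (outcome k (land p h)) _ ok′) f Js
  opposingJumps-sound (suc n) rep ok f (more J Js) | d , () | top    | _
  opposingJumps-sound (suc n) rep ok f (more J Js) | d , () | bottom | _
  opposingJumps-sound (suc n) rep ok f (more J Js) | d , m | stuck | ()

  -- A placement counts as the ball landing where it already is, so `outcome` serves for both kinds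
  -- of move.
  opposingPlacement : (Point → Grid → Point → Bool) → Grid → Point → Point → Bool
  opposingPlacement k g q p = at g p ∨ p == q ∨ outcome (k p) (land q (put g p true))

  opposingPlacement-sound :
    ∀ k {P} {cf q g} p → Rep cf q g → opposingPlacement k g q p ≡ true →
    (∀ {cf q g} → Rep cf q g → k p g q ≡ true → Safe (cf , P)) →
    OnBoard p → NoChap (chaps cf) p → p ≢ ball cf →
    Good X Safe P (classify (onBoard (config (ball cf) (setAt (chaps cf) p true))))
  opposingPlacement-sound k {q = q} {g} p (refl , cf≈g) ok f on nc p≢q
    with at g p in e | p == q in e′
  ... | true  | _     = ⊥-elim (not-¬ refl (trans (sym nc) (trans (cf≈g _ _ on) e)))
  ... | false | true  = ⊥-elim (p≢q (==-true _ _ e′))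
  ... | false | false =
    outcome-sound (land q (put g p true)) (_ , refl , refl , setAt-≈ {g = g} p true on cf≈g) ok f

  -- The number bounds the depth of the recursion.  act and answer reject  loop , so that the
  -- continuation prescribed at a configuration in  loops  makes at least one move.
  act    : ℕ → Att → Grid → Point → Bool
  attack : ℕ → Att → Grid → Point → Bool
  answer : ℕ → Def → Grid → Point → Bool
  defend : ℕ → Def → Grid → Point → Bool

  act n loop        g q = false
  act n (jump d ds δ) g q = own (follow d ds g q)
    where
    own : Ray → Bool
    own r = proper r ∧ outcome (defend n δ) r
  act n (place p δ) g q =
    onBoard? p ∧ not (at g p) ∧ not (p == q) ∧ outcome (defend n δ) (land q (put g p true))

  attack zero    a    g q = false
  attack (suc n) loop g q = is X Alfred ∧ inLoops g q loops
  attack (suc n) a    g q = act n a g q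

  answer n loop            g q = false
  answer n (reply a ps js) g q =
    allCells (opposingPlacement (λ p → attack n (find p ps a)) g q)
    ∧ opposingJumps 20 (λ h p → attack n (find p js a) h p) g q

  defend zero    δ    g q = false
  defend (suc n) loop g q = is X Betty ∧ inLoops g q loops
  defend (suc n) δ    g q = answer n δ g q

  -- Yields the move itself and not just a member of `Safe`. This is what a recurring configuration
  -- needs, as `Safe` stores no move there.
  act-sound    : ∀ n a {cf q g} → Rep cf q g → act n a g q ≡ true →
                 ∃ λ L → Move cf L × Good X Safe (other X) (classify L)
  attack-sound : ∀ n a {cf q g} → Rep cf q g → attack n a g q ≡ true → Safe (cf , X)
  answer-sound : ∀ n δ {cf q g} → Rep cf q g → answer n δ g q ≡ true →
                 ∀ L → Move cf L → Good X Safe X (classify L)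
  defend-sound : ∀ n δ {cf q g} → Rep cf q g → defend n δ g q ≡ true → Safe (cf , other X)

  act-sound n (jump d ds δ) {q = q} {g} rep ok with follow-sound d ds rep (∧-conicalˡ _ _ ok)
  ... | L , Js , m = L , jumps Js ,
    outcome-sound (follow d ds g q) m (∧-conicalʳ (proper (follow d ds g q)) _ ok) (defend-sound n δ)
  act-sound n (place p δ) {cf} {q} {g} rep@(refl , cf≈g) ok with onBoard? p in o | at g p in e | p == q in p≟q
  ... | true | false | false = _ ,
    place p on (trans (cf≈g _ _ on) e) (λ { refl → not-¬ refl (trans (sym p≟q) (==-refl p on)) }) ,
    outcome-sound (land q (put g p true)) (_ , refl , refl , setAt-≈ {g = g} p true on cf≈g) ok (defend-sound n δ)
    where on = onBoard?-sound p o

  attack-sound (suc n) loop rep ok with is-sound X Alfred (∧-conicalˡ _ _ ok)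
  ... | refl = loop rep (inLoops-sound _ _ loops ok)
  attack-sound (suc n) a@(jump _ _ _)  rep ok = let _ , M , s = act-sound n a rep ok in move M s
  attack-sound (suc n) a@(place _ _) rep ok = let _ , M , s = act-sound n a rep ok in move M s

  answer-sound n (reply a ps js) {q = q} {g} rep ok _ (place p on nc p≢q) =
    opposingPlacement-sound k p rep
      (allCells-sound (opposingPlacement k g q) (∧-conicalˡ (allCells (opposingPlacement k g q)) _ ok) p on)
      (attack-sound n (find p ps a)) on nc p≢q
    where k = λ p → attack n (find p ps a)
  answer-sound n (reply a ps js) {q = q} {g} rep ok _ (jumps Js) =
    opposingJumps-sound 20 {k = λ h p → attack n (find p js a) h p} rep
      (∧-conicalʳ (allCells (opposingPlacement (λ p → attack n (find p ps a)) g q)) _ ok)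
      (λ {_} {p} → attack-sound n (find p js a)) Js

  defend-sound (suc n) loop rep ok with is-sound X Betty (∧-conicalˡ _ _ ok)
  ... | refl = loop rep (inLoops-sound _ _ loops ok)
  defend-sound (suc n) δ@(reply _ _ _) rep ok = wait refl (answer-sound n δ rep ok)

-- The recurring configurations and both strategies.

infix 7 _∙_
_∙_ : ℕ → ℕ → Point
r ∙ c = + r , + c

infix 6 _⇒_
_⇒_ : Point → Att → Point × Att
p ⇒ a = p , a

-- The continuation is never consulted when the jumps end in the goal.
win : Dir → List Dir → Att
win d ds = jump d ds loop

pattern ■ = true
pattern □ = false

-- The points (5 , 4), (6 , 5) and (7 , 6) are empty, so the same chaps go with either position of
-- the ball.
grid : Grid
grid =
  ( (□ ∷ ■ ∷ □ ∷ ■ ∷ ■ ∷ ■ ∷ □ ∷ ■ ∷ ■ ∷ □ ∷ []) ∷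
    (□ ∷ □ ∷ □ ∷ ■ ∷ ■ ∷ □ ∷ ■ ∷ □ ∷ ■ ∷ ■ ∷ []) ∷
    (□ ∷ ■ ∷ □ ∷ ■ ∷ ■ ∷ ■ ∷ □ ∷ ■ ∷ □ ∷ □ ∷ []) ∷
    (□ ∷ □ ∷ □ ∷ ■ ∷ □ ∷ ■ ∷ □ ∷ □ ∷ □ ∷ ■ ∷ []) ∷
    (■ ∷ ■ ∷ ■ ∷ □ ∷ □ ∷ □ ∷ □ ∷ ■ ∷ □ ∷ □ ∷ []) ∷
    (□ ∷ □ ∷ ■ ∷ □ ∷ □ ∷ □ ∷ ■ ∷ □ ∷ □ ∷ ■ ∷ []) ∷
    (■ ∷ ■ ∷ □ ∷ □ ∷ ■ ∷ □ ∷ □ ∷ □ ∷ □ ∷ ■ ∷ []) ∷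
    (■ ∷ ■ ∷ ■ ∷ ■ ∷ □ ∷ □ ∷ □ ∷ □ ∷ □ ∷ ■ ∷ []) ∷
    (■ ∷ □ ∷ □ ∷ □ ∷ □ ∷ □ ∷ □ ∷ □ ∷ ■ ∷ ■ ∷ []) ∷
    (■ ∷ □ ∷ ■ ∷ □ ∷ ■ ∷ □ ∷ □ ∷ □ ∷ □ ∷ ■ ∷ []) ∷
    (□ ∷ □ ∷ □ ∷ ■ ∷ ■ ∷ □ ∷ ■ ∷ ■ ∷ □ ∷ ■ ∷ []) ∷
    (■ ∷ ■ ∷ ■ ∷ ■ ∷ ■ ∷ □ ∷ □ ∷ ■ ∷ ■ ∷ □ ∷ []) ∷ [])

loops : List (Point × Grid)
loops = (5 ∙ 4 , grid) ∷ (7 ∙ 6 , grid) ∷ []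

-- The threat is to jump to (7 , 4), over the new chap to (3 , 8), and up-left past the top row.
alfred₁ : Att
alfred₁ = place (6 ∙ 5) (reply (win down (upRight ∷ upLeft ∷ []))
    (7 ∙ 4 ⇒ win down (upLeft ∷ up ∷ upRight ∷ []) ∷ [])
    (7 ∙ 4 ⇒ win upRight (upLeft ∷ []) ∷
     3 ∙ 8 ⇒ win upLeft [] ∷
     7 ∙ 6 ⇒ loop ∷ []))

-- The threat is to add a chap at (5 , 4), jump to (4 , 3) and leave upwards. A further chap at (4 ,
-- 3) only carries the ball to (3 , 2), which has an exit up-right.
alfred₂ : Att
alfred₂ = place (6 ∙ 5) (reply (place (5 ∙ 4) (reply (win upLeft (up ∷ []))
        (4 ∙ 3 ⇒ win upLeft (upRight ∷ []) ∷ [])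
        (4 ∙ 3 ⇒ win up [] ∷ [])))
    (3 ∙ 2 ⇒ place (5 ∙ 4) (reply (win upLeft (up ∷ []))
        (4 ∙ 3 ⇒ win upLeft (upRight ∷ []) ∷ [])
        (4 ∙ 3 ⇒ win upLeft (upRight ∷ []) ∷
         1 ∙ 0 ⇒ win upRight [] ∷ [])) ∷
     4 ∙ 3 ⇒ win upLeft (upLeft ∷ upRight ∷ []) ∷
     4 ∙ 4 ⇒ win upLeft (up ∷ up ∷ []) ∷
     5 ∙ 3 ⇒ win upLeft (left ∷ upRight ∷ up ∷ []) ∷
     5 ∙ 4 ⇒ win upLeft (up ∷ []) ∷
     6 ∙ 6 ⇒ win up (upLeft ∷ []) ∷
     6 ∙ 7 ⇒ win upRight (upLeft ∷ upRight ∷ []) ∷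
     7 ∙ 5 ⇒ win left (upRight ∷ upLeft ∷ []) ∷
     7 ∙ 7 ⇒ win right (down ∷ downLeft ∷ right ∷ up ∷ up ∷ up ∷ []) ∷
     8 ∙ 5 ⇒ win upLeft (down ∷ downRight ∷ down ∷ right ∷ up ∷ up ∷ up ∷ []) ∷
     8 ∙ 6 ⇒ win down (down ∷ right ∷ up ∷ up ∷ up ∷ []) ∷
     8 ∙ 7 ⇒ win downRight (downLeft ∷ right ∷ up ∷ up ∷ up ∷ []) ∷ [])
    (5 ∙ 4 ⇒ loop ∷
     -- Betty has jumped over (6 , 5) and on over (6 , 4). A new chap at (6 , 5) restores the route
     -- by (3 , 8).
     7 ∙ 4 ⇒ place (6 ∙ 5) (reply (win upRight (upLeft ∷ []))
        []
        (3 ∙ 8 ⇒ win upLeft [] ∷ [])) ∷ []))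

-- The usual threat is to jump to (7 , 4), over the chap at (8 , 3) to (10 , 1), and down past the
-- bottom row.
betty₁ : Def
betty₁ = reply (place (8 ∙ 3) (reply (win down (downLeft ∷ down ∷ []))
       (7 ∙ 4 ⇒ win down (down ∷ []) ∷
        -- Now the diagonal is full as far as (11 , 0), and the ball leaves through that corner,
        -- which counts as the bottom line.
        10 ∙ 1 ⇒ win down (downLeft ∷ []) ∷ [])
       (7 ∙ 4 ⇒ win downLeft (down ∷ []) ∷
        10 ∙ 1 ⇒ win down [] ∷ [])))
   (4 ∙ 3 ⇒ win upLeft (down ∷ downRight ∷ down ∷ []) ∷
    4 ∙ 4 ⇒ win up (left ∷ down ∷ downRight ∷ down ∷ []) ∷
    4 ∙ 5 ⇒ win upRight (upRight ∷ down ∷ down ∷ down ∷ []) ∷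
    5 ∙ 3 ⇒ win left (down ∷ downRight ∷ []) ∷
    5 ∙ 5 ⇒ win right (up ∷ up ∷ left ∷ downLeft ∷ down ∷ downRight ∷ []) ∷
    6 ∙ 3 ⇒ win downLeft (downRight ∷ []) ∷
    7 ∙ 4 ⇒ win down (down ∷ []) ∷
    7 ∙ 5 ⇒ place (8 ∙ 3) (reply (win down (downLeft ∷ down ∷ []))
       (7 ∙ 4 ⇒ win down (down ∷ []) ∷
        10 ∙ 1 ⇒ win down (downLeft ∷ []) ∷ [])
       (7 ∙ 4 ⇒ win downLeft (down ∷ []) ∷
        7 ∙ 6 ⇒ place (8 ∙ 5) (reply (win downLeft [])
           []
           []) ∷
        10 ∙ 1 ⇒ win down [] ∷ [])) ∷
    8 ∙ 3 ⇒ win down (downLeft ∷ down ∷ []) ∷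
    8 ∙ 4 ⇒ win down (down ∷ []) ∷
    8 ∙ 5 ⇒ win down (downRight ∷ down ∷ []) ∷
    9 ∙ 1 ⇒ place (8 ∙ 4) (reply (win down (down ∷ []))
       (7 ∙ 4 ⇒ win down [] ∷ [])
       (7 ∙ 4 ⇒ win down [] ∷ [])) ∷
    10 ∙ 1 ⇒ place (8 ∙ 4) (reply (win down (down ∷ []))
       (7 ∙ 4 ⇒ win down [] ∷ [])
       (7 ∙ 4 ⇒ win down [] ∷ [])) ∷
    10 ∙ 2 ⇒ place (8 ∙ 4) (reply (win down (down ∷ []))
       (7 ∙ 4 ⇒ win down [] ∷ [])
       (7 ∙ 4 ⇒ win down [] ∷ [])) ∷
    6 ∙ 5 ⇒ jump downRight [] loop ∷ [])
   (7 ∙ 4 ⇒ place (8 ∙ 3) (reply (win downLeft (down ∷ []))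
       (10 ∙ 1 ⇒ win downLeft [] ∷ [])
       (10 ∙ 1 ⇒ win downLeft [] ∷ [])) ∷ [])

-- A chap at (8 , 5) completes a diagonal running off the bottom row, which no placement can
-- interrupt.
betty₂ : Def
betty₂ = reply (place (8 ∙ 5) (reply (win downLeft [])
       []
       []))
   (6 ∙ 6 ⇒ win up (upLeft ∷ right ∷ right ∷ down ∷ down ∷ down ∷ []) ∷
    6 ∙ 7 ⇒ win upRight (upLeft ∷ upRight ∷ down ∷ down ∷ down ∷ []) ∷
    -- The chap at (7 , 5) offers Alfred a jump to (7 , 4). Filling (7 , 4) extends the line to the
    -- sideline and makes that jump illegal.
    7 ∙ 5 ⇒ place (7 ∙ 4) (reply (place (8 ∙ 5) (reply (win downLeft [])
           []
           []))
       (6 ∙ 5 ⇒ win upLeft (down ∷ down ∷ []) ∷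
        6 ∙ 6 ⇒ win up (upLeft ∷ right ∷ right ∷ down ∷ down ∷ down ∷ []) ∷
        6 ∙ 7 ⇒ win upRight (upLeft ∷ upRight ∷ down ∷ down ∷ down ∷ []) ∷
        7 ∙ 7 ⇒ win right (down ∷ downLeft ∷ []) ∷
        8 ∙ 5 ⇒ win downLeft [] ∷
        8 ∙ 6 ⇒ win down (down ∷ []) ∷
        8 ∙ 7 ⇒ win downRight (downLeft ∷ []) ∷ [])
       []) ∷
    7 ∙ 7 ⇒ win right (down ∷ downLeft ∷ []) ∷
    8 ∙ 5 ⇒ win downLeft [] ∷
    8 ∙ 6 ⇒ win down (down ∷ []) ∷
    8 ∙ 7 ⇒ win downRight (downLeft ∷ []) ∷
    6 ∙ 5 ⇒ jump upLeft [] loop ∷ [])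
   []

-- Neither player loses.

module A = Strategy Alfred loops
module B = Strategy Betty loops

alfred-avoids-loss : ∀ {cf q} → Rep cf q grid → (q , grid) ∈ loops → CanAvoidLoss Alfred (cf , Alfred)
alfred-avoids-loss rep mem = A.Safe , A.loop rep mem , own , opposing
  where
  own : ∀ cf → A.Safe (cf , Alfred) → ∃ λ L → Move cf L × Good Alfred A.Safe Betty (classify L)
  -- The last `refl` evaluates the whole tree; its leaves lead back into `Safe`, which closes the
  -- cycle.
  own _ (A.loop rep (here refl))         = A.act-sound 9 alfred₁ rep refl
  own _ (A.loop rep (there (here refl))) = A.act-sound 9 alfred₂ rep refl
  own _ (A.move M s)                     = _ , M , s
  own _ (A.wait () _)

  opposing : ∀ cf → A.Safe (cf , Betty) → ∀ L → Move cf L → Good Alfred A.Safe Alfred (classify L)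
  opposing _ (A.wait _ f) = f

betty-avoids-loss : ∀ {cf q} → Rep cf q grid → (q , grid) ∈ loops → CanAvoidLoss Betty (cf , Alfred)
betty-avoids-loss rep mem = B.Safe , B.loop rep mem , own , opposing
  where
  own : ∀ cf → B.Safe (cf , Betty) → ∃ λ L → Move cf L × Good Betty B.Safe Alfred (classify L)
  own _ (B.move M s) = _ , M , s
  own _ (B.wait () _)

  opposing : ∀ cf → B.Safe (cf , Alfred) → ∀ L → Move cf L → Good Betty B.Safe Betty (classify L)
  opposing _ (B.loop rep (here refl))         = B.answer-sound 9 betty₁ rep refl
  opposing _ (B.loop rep (there (here refl))) = B.answer-sound 9 betty₂ rep refl
  opposing _ (B.wait _ f)                     = f

theorem1 : Σ Position λ pos → ValidPosition pos × Drawn pos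
theorem1 = (start , Alfred) , (onBoard?-sound (5 ∙ 4) refl , +≤+ (s≤s z≤n) , +≤+ (ℕₚ.m≤m+n 5 5) , refl) ,
           alfred-avoids-loss rep (here refl) , betty-avoids-loss rep (here refl)
  where
  start : Config
  start = config (5 ∙ 4) (λ r c → at grid (r , c))

  rep : Rep start (5 ∙ 4) grid
  rep = refl , λ _ _ _ → refl
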